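{- Let $G$ be a graph without isolated vertices and $H$ a graph. Write $n=|V(H)|$. The following statements hold. (i) For any $\gamma_R^p(G)$-function $f(V_0,V_1,V_2)$, $$\gamma_R^p(G\circ H)\le \gamma_R^p(G)+(|V_1|+|V_2|)(n-1).$$ (ii) If there exists a $\gamma_R^p(G)$-function $f(V_0,V_1,V_2)$ such that $V_2$ is a $\gamma(G)$-set, then $$\gamma_R^p(G\circ H)\le \gamma_R^p(G)\,n-\gamma(G)(n-1).$$ (iii) If $S$ is a $\gamma^p(G)$-set, $S'=\{x\in S:\ \operatorname{epn}(x,S)=\varnothing\}$ and $S''=S\setminus S'$, then $$\gamma_R^p(G\circ H)\le |S'|+2|S''|+\gamma^p(G)(n-1).$$ (iv) If there exists a $\gamma_R^p(G)$-function $f(V_0,V_1,V_2)$ such that $V_1\cup V_2$ is a $\gamma^p(G)$-set, then $$\gamma_R^p(G\circ H)\le \gamma_R^p(G)+\gamma^p(G)(n-1).$$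
   Context: All graphs are finite, simple and undirected, with at least one vertex. $N(v)$ is the open neighbourhood of $v$. A dominating set is a set $S$ such that every vertex outside $S$ has at least one neighbour in $S$; $\gamma(G)$ is the minimum size of one, and a $\gamma(G)$-set is a dominating set of size $\gamma(G)$. A perfect dominating set is a set $S$ such that every vertex outside $S$ has exactly one neighbour in $S$; $\gamma^p(G)$ is the minimum size of one, and a $\gamma^p(G)$-set is a perfect dominating set of size $\gamma^p(G)$. For $v\in S\subseteq V(G)$, the external private neighbourhood is $\operatorname{epn}(v,S)=\{u\in V(G)\setminus S:\ N(u)\cap S=\{v\}\}$. A perfect Roman dominating function (PRDF) on a graph $\Gamma$ is a function $f:V(\Gamma)\to\{0,1,2\}$ such that every vertex $u$ with $f(u)=0$ is adjacent to exactly one vertex $v$ with $f(v)=2$. Its weight is $\sum_v f(v)$; $\gamma_R^p(\Gamma)$ is the minimum weight of a PRDF, and a $\gamma_R^p(\Gamma)$-function is a PRDF of weight $\gamma_R^p(\Gamma)$. The notation $f(V_0,V_1,V_2)$ means $V_i=\{v: f(v)=i\}$. The lexicographic product $G\circ H$ has vertex set $V(G)\times V(H)$, with $(u,v)$ adjacent to $(x,y)$ iff $ux\in E(G)$, or $u=x$ and $vy\in E(H)$. -}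

module Defs where

open import Data.Bool using () renaming (_≟_ to _≟ᵇ_)
open import Data.Fin using (Fin; zero; suc; toℕ; remQuot; finToFun; funToFin)
open import Data.Fin.Properties
  using (_≟_; all?; any?; finToFun-funToFin)
open import Data.Fin.Subset
  using (Subset; _∉_; _∩_; ⁅_⁆; ∣_∣; Nonempty; ⊤)
open import Data.Fin.Subset.Properties
  using (_∈?_; ∈⊤; nonempty?; anySubset?)
open import Data.Nat using (ℕ; zero; suc; _*_; _^_; _≤_; z≤n; s≤s; NonZero)
import Data.Nat.Properties as ℕ
open import Data.Product using (∃; ∃-syntax; _×_; _,_; proj₁; proj₂)
open import Data.Sum using (_⊎_; inj₁; inj₂)
open import Data.Vec using (tabulate)
open import Data.Vec.Properties using (≡-dec; tabulate-cong)
open import Data.Empty using (⊥-elim)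
open import Relation.Binary using (Symmetric; Irreflexive) renaming (Decidable to Decidable₂)
open import Relation.Binary.PropositionalEquality
  using (_≡_; _≗_; refl; sym; trans; cong; subst)
open import Relation.Nullary using (yes; no; does; ¬_; ¬?; _×-dec_; _⊎-dec_; _→-dec_)
open import Relation.Nullary.Decidable using (map′)
open import Relation.Unary using (Pred; Decidable)
open import Algebra.Properties.Monoid.Sum ℕ.+-0-monoid using (sum-syntax; sum-cong-≗)
open import Level using (0ℓ)

IsLeast : Pred ℕ 0ℓ → ℕ → Set
IsLeast P k = P k × (∀ {j} → P j → k ≤ j)

least : {P : Pred ℕ 0ℓ} → Decidable P → ∀ n → P n → ∃ (IsLeast P)
least {P} P? zero p = zero , p , λ _ → z≤n
least {P} P? (suc n) p with P? zero
... | yes p₀ = zero , p₀ , λ _ → z≤n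
... | no ¬p₀ with least (λ k → P? (suc k)) n p
...   | k , pk , min = suc k , pk , bound
  where
  bound : ∀ {j} → P j → suc k ≤ j
  bound {zero}  q = ⊥-elim (¬p₀ q)
  bound {suc j} q = s≤s (min q)

comprehension : ∀ {n} {P : Pred (Fin n) 0ℓ} → Decidable P → Subset n
comprehension P? = tabulate (λ v → does (P? v))

record Graph (n : ℕ) : Set₁ where
  infix 4 _~_ _~?_
  field
    _~_      : Fin n → Fin n → Set
    _~?_     : Decidable₂ _~_
    ~-sym    : Symmetric _~_
    ~-irrefl : Irreflexive _≡_ _~_
    nonEmpty : NonZero n

  N : Fin n → Subset n
  N u = comprehension (u ~?_)

NoIsolatedVertices : ∀ {n} → Graph n → Set
NoIsolatedVertices G = ∀ u → ∃[ v ] (u ~ v)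
  where open Graph G

-- The vertex set Fin m × Fin n of the product is encoded as Fin (m * n)
-- through the library bijection remQuot / combine.
infixl 7 _∘_
_∘_ : ∀ {m n} → Graph m → Graph n → Graph (m * n)
_∘_ {m} {n} G H = record
  { _~_      = λ p q → Adj (remQuot n p) (remQuot n q)
  ; _~?_     = λ p q → adj? (remQuot n p) (remQuot n q)
  ; ~-sym    = adj-sym
  ; ~-irrefl = λ { refl → adj-irrefl }
  ; nonEmpty = ℕ.m*n≢0 m n {{G.nonEmpty}} {{H.nonEmpty}}
  }
  where
  module G = Graph G
  module H = Graph H

  Adj : Fin m × Fin n → Fin m × Fin n → Set
  Adj (u , v) (x , y) = u G.~ x ⊎ (u ≡ x × v H.~ y)

  adj? : Decidable₂ Adj
  adj? (u , v) (x , y) = (u G.~? x) ⊎-dec ((u ≟ x) ×-dec (v H.~? y))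

  adj-sym : Symmetric (λ p q → Adj (remQuot n p) (remQuot n q))
  adj-sym (inj₁ a)       = inj₁ (G.~-sym a)
  adj-sym (inj₂ (e , b)) = inj₂ (sym e , H.~-sym b)

  adj-irrefl : ∀ {a} → ¬ Adj a a
  adj-irrefl (inj₁ a)       = G.~-irrefl refl a
  adj-irrefl (inj₂ (_ , b)) = H.~-irrefl refl b

module _ {n : ℕ} (G : Graph n) where
  open Graph G

  Dominating : Subset n → Set
  Dominating S = ∀ u → u ∉ S → Nonempty (N u ∩ S)

  PerfectDominating : Subset n → Set
  PerfectDominating S = ∀ u → u ∉ S → ∣ N u ∩ S ∣ ≡ 1

  dominating? : Decidable Dominating
  dominating? S = all? λ u → ¬? (u ∈? S) →-dec nonempty? (N u ∩ S)

  perfectDominating? : Decidable PerfectDominating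
  perfectDominating? S = all? λ u → ¬? (u ∈? S) →-dec (∣ N u ∩ S ∣ ℕ.≟ 1)

  γ-least : ∃ (IsLeast (λ k → ∃[ S ] Dominating S × ∣ S ∣ ≡ k))
  γ-least = least (λ k → anySubset? λ S → dominating? S ×-dec (∣ S ∣ ℕ.≟ k))
                  _ (⊤ , (λ u u∉⊤ → ⊥-elim (u∉⊤ ∈⊤)) , refl)

  γᵖ-least : ∃ (IsLeast (λ k → ∃[ S ] PerfectDominating S × ∣ S ∣ ≡ k))
  γᵖ-least = least (λ k → anySubset? λ S → perfectDominating? S ×-dec (∣ S ∣ ℕ.≟ k))
                   _ (⊤ , (λ u u∉⊤ → ⊥-elim (u∉⊤ ∈⊤)) , refl)

  γ γᵖ : ℕ
  γ  = proj₁ γ-least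
  γᵖ = proj₁ γᵖ-least

  IsγSet IsγᵖSet : Subset n → Set
  IsγSet  S = Dominating S × ∣ S ∣ ≡ γ
  IsγᵖSet S = PerfectDominating S × ∣ S ∣ ≡ γᵖ

  -- {u ∉ S : N(u) ∩ S = {v}}; the case of interest is v ∈ S.
  epn : Fin n → Subset n → Subset n
  epn v S = comprehension λ u → ¬? (u ∈? S) ×-dec ≡-dec _≟ᵇ_ (N u ∩ S) ⁅ v ⁆

  -- {x ∈ S : epn(x , S) = ∅}
  withoutEpn : Subset n → Subset n
  withoutEpn S = comprehension λ x → (x ∈? S) ×-dec ¬? (nonempty? (epn x S))

infix 8 _⁻¹[_]
_⁻¹[_] : ∀ {n} → (Fin n → Fin 3) → Fin 3 → Subset n
f ⁻¹[ i ] = comprehension λ v → f v ≟ i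

V₁ V₂ : ∀ {n} → (Fin n → Fin 3) → Subset n
V₁ f = f ⁻¹[ suc zero ]
V₂ f = f ⁻¹[ suc (suc zero) ]

weight : ∀ {n} → (Fin n → Fin 3) → ℕ
weight {n} f = ∑[ v < n ] toℕ (f v)

module _ {n : ℕ} (G : Graph n) where
  open Graph G

  IsPRDF : (Fin n → Fin 3) → Set
  IsPRDF f = ∀ u → f u ≡ zero → ∣ N u ∩ V₂ f ∣ ≡ 1

  isPRDF? : Decidable IsPRDF
  isPRDF? f = all? λ u → (f u ≟ zero) →-dec (∣ N u ∩ V₂ f ∣ ℕ.≟ 1)

  isPRDF-resp : ∀ {f g} → f ≗ g → IsPRDF f → IsPRDF g
  isPRDF-resp {f} {g} f≗g p u gu≡0 =
    subst (λ S → ∣ N u ∩ S ∣ ≡ 1)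
          (tabulate-cong λ v → cong (λ i → does (i ≟ suc (suc zero))) (f≗g v))
          (p u (trans (f≗g u) gu≡0))

  hasPRDFOfWeight? : Decidable (λ k → ∃[ f ] IsPRDF f × weight f ≡ k)
  hasPRDFOfWeight? k =
    map′ (λ { (c , p) → finToFun c , p })
         (λ { (f , p , w) → funToFin f
            , isPRDF-resp (λ v → sym (finToFun-funToFin f v)) p
            , trans (sum-cong-≗ (λ v → cong toℕ (finToFun-funToFin f v))) w })
         (any? {n = 3 ^ n} λ c → isPRDF? (finToFun c) ×-dec (weight {n} (finToFun c) ℕ.≟ k))

  γᵖᴿ-least : ∃ (IsLeast (λ k → ∃[ f ] IsPRDF f × weight f ≡ k))
  γᵖᴿ-least = least hasPRDFOfWeight? _ ((λ _ → suc zero) , (λ _ ()) , refl)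

  γᵖᴿ : ℕ
  γᵖᴿ = proj₁ γᵖᴿ-least

  IsγᵖᴿFunction : (Fin n → Fin 3) → Set
  IsγᵖᴿFunction f = IsPRDF f × weight f ≡ γᵖᴿ

{-# OPTIONS --safe #-}

-- A perfect Roman dominating function f on G lifts to G ∘ H: put 0 on every
-- copy of H over V₀, put 1 on every copy over V₁ ∪ V₂, and then raise a single
-- fixed vertex of each copy over V₂ to 2. A vertex of value 0 lies in a copy of
-- value 0 throughout, so it sees the raised vertices exactly over its neighbours
-- in V₂, of which there is one. The lift has weight |V₁| n + |V₂| (n + 1), and
-- (i), (ii) and (iv) are this bound rewritten. For (iii) apply it to the function
-- with V₁ = S′ and V₂ = S″: the only neighbour in S of a vertex outside S has that
-- vertex as an external private neighbour, hence lies in S″.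
module Submission where

open import Defs
open import Data.Nat using (ℕ; _+_; _*_; _∸_; _≤_)
open import Data.Integer using (+_) renaming (_≤_ to _≤ᶻ_; _-_ to _-ᶻ_)
open import Data.Fin using (Fin)
open import Data.Fin.Subset using (Subset; _∪_; _─_; ∣_∣)
open import Data.Product using (∃; _×_)

open import Data.Bool using (Bool; true; false) renaming (_≟_ to _≟ᵇ_)
open import Data.Empty using (⊥-elim)
open import Data.Fin using (zero; suc; toℕ; remQuot; combine; _↑ˡ_; _↑ʳ_)
open import Data.Fin.Properties using (_≟_; remQuot-combine; combine-remQuot)
open import Data.Fin.Subset using (_∈_; _∉_; _⊆_; _∩_; ⁅_⁆; ⊥; Nonempty)
open import Data.Fin.Subset.Properties
  using (∣⁅x⁆∣≡1; x∈⁅x⁆; x∈⁅y⁆⇒x≡y; x∈p∩q⁺; x∈p∩q⁻; x∈p∪q⁻; q⊆p∪q; p─q⊆p; ⊆-antisym;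
         _∈?_; nonempty?; x∈p∧x∉q⇒x∈p─q)
open import Data.Integer using (_⊖_; +≤+)
import Data.Integer.Properties as ℤ
open import Data.Nat using (zero; suc; ≢-nonZero⁻¹)
import Data.Nat.Properties as ℕ
open import Data.Nat.Solver using (module +-*-Solver)
open import Data.Product using (_,_; proj₁; proj₂; uncurry)
open import Data.Sum using (inj₁; inj₂; [_,_]′)
open import Data.Vec using ([]; _∷_; lookup)
open import Data.Vec.Properties using ([]=⇒lookup; lookup⇒[]=; lookup∘tabulate; ≡-dec)
open import Function using (id; case_of_) renaming (_∘_ to _⊙_)
open import Level using (0ℓ)
open import Relation.Binary.PropositionalEquality
open import Relation.Nullary using (yes; does; ¬_; ¬?; _×-dec_)
open import Relation.Nullary.Decidable using (dec-true)
open import Relation.Unary using (Pred; Decidable)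
open import Algebra.Properties.Monoid.Sum ℕ.+-0-monoid
  using (sum-syntax; sum-cong-≗; sum-replicate-zero)
open +-*-Solver using (solve; _:+_; _:*_; _:=_; con)

private
  variable
    m n k : ℕ

-- Membership in comprehensions and cardinalities of finite subsets.

module _ {P : Pred (Fin n) 0ℓ} (P? : Decidable P) where

  ∈-comprehension⁺ : ∀ {v} → P v → v ∈ comprehension P?
  ∈-comprehension⁺ {v} p = lookup⇒[]= v _ (trans (lookup∘tabulate _ v) (dec-true (P? v) p))

  ∈-comprehension⁻ : ∀ {v} → v ∈ comprehension P? → P v
  ∈-comprehension⁻ {v} v∈ with P? v | trans (sym (lookup∘tabulate (does ⊙ P?) v)) ([]=⇒lookup v∈)
  ... | yes p | _ = p

∣p∣≡0⇒p≡⊥ : (p : Subset n) → ∣ p ∣ ≡ 0 → p ≡ ⊥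
∣p∣≡0⇒p≡⊥ []          _ = refl
∣p∣≡0⇒p≡⊥ (false ∷ p) e = cong (false ∷_) (∣p∣≡0⇒p≡⊥ p e)

∣p∣≡1⇒p≡⁅x⁆ : (p : Subset n) → ∣ p ∣ ≡ 1 → ∃ λ x → p ≡ ⁅ x ⁆
∣p∣≡1⇒p≡⁅x⁆ (true  ∷ p) e = zero , cong (true ∷_) (∣p∣≡0⇒p≡⊥ p (ℕ.suc-injective e))
∣p∣≡1⇒p≡⁅x⁆ (false ∷ p) e with x , eq ← ∣p∣≡1⇒p≡⁅x⁆ p e = suc x , cong (false ∷_) eq

unique⇒∣p∣≡1 : ∀ {p : Subset n} {x} → x ∈ p → (∀ {y} → y ∈ p → y ≡ x) → ∣ p ∣ ≡ 1
unique⇒∣p∣≡1 {p = p} {x} x∈p uniq = trans (cong ∣_∣ p≡⁅x⁆) (∣⁅x⁆∣≡1 x)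
  where
  p≡⁅x⁆ : p ≡ ⁅ x ⁆
  p≡⁅x⁆ = ⊆-antisym (λ y∈p → subst (_∈ ⁅ x ⁆) (sym (uniq y∈p)) (x∈⁅x⁆ x))
                    (λ y∈⁅x⁆ → subst (_∈ p) (sym (x∈⁅y⁆⇒x≡y x y∈⁅x⁆)) x∈p)

-- The difference makes the union disjoint. This form serves both `V₁ f ∪ V₂ f` and the splitting of
-- S into S′ and S″.
∣p∪q∣≡∣p∣+∣q─p∣ : (p q : Subset n) → ∣ p ∪ q ∣ ≡ ∣ p ∣ + ∣ q ─ p ∣
∣p∪q∣≡∣p∣+∣q─p∣ []          []          = refl
∣p∪q∣≡∣p∣+∣q─p∣ (true  ∷ p) (_     ∷ q) = cong suc (∣p∪q∣≡∣p∣+∣q─p∣ p q)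
∣p∪q∣≡∣p∣+∣q─p∣ (false ∷ p) (true  ∷ q) =
  trans (cong suc (∣p∪q∣≡∣p∣+∣q─p∣ p q)) (sym (ℕ.+-suc ∣ p ∣ ∣ q ─ p ∣))
∣p∪q∣≡∣p∣+∣q─p∣ (false ∷ p) (false ∷ q) = ∣p∪q∣≡∣p∣+∣q─p∣ p q

p⊆q⇒p∪q≡q : {p q : Subset n} → p ⊆ q → p ∪ q ≡ q
p⊆q⇒p∪q≡q {p = p} {q} p⊆q = ⊆-antisym (λ x∈ → [ p⊆q , id ]′ (x∈p∪q⁻ p q x∈)) (q⊆p∪q p q)

-- Value classes, weights and sums over a product.

V₂─V₁≡V₂ : (f : Fin n → Fin 3) → V₂ f ─ V₁ f ≡ V₂ f
V₂─V₁≡V₂ {zero}  f = refl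
V₂─V₁≡V₂ {suc n} f with f zero
... | zero         = cong (false ∷_) (V₂─V₁≡V₂ (f ⊙ suc))
... | suc zero     = cong (false ∷_) (V₂─V₁≡V₂ (f ⊙ suc))
... | suc (suc zero) = cong (true ∷_) (V₂─V₁≡V₂ (f ⊙ suc))

∣V₁∪V₂∣≡∣V₁∣+∣V₂∣ : (f : Fin n → Fin 3) → ∣ V₁ f ∪ V₂ f ∣ ≡ ∣ V₁ f ∣ + ∣ V₂ f ∣
∣V₁∪V₂∣≡∣V₁∣+∣V₂∣ f =
  trans (∣p∪q∣≡∣p∣+∣q─p∣ (V₁ f) (V₂ f)) (cong (λ p → ∣ V₁ f ∣ + ∣ p ∣) (V₂─V₁≡V₂ f))

-- Since `w` vanishes at 0, the vertices of V₀ contribute nothing. With `w = toℕ` this computes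
-- `weight f`; with `w` the weight of a whole copy of H it computes the weight of the lift.
sum-by-value : (w : Fin 3 → ℕ) → w zero ≡ 0 → (f : Fin m → Fin 3) →
  ∑[ v < m ] w (f v) ≡ ∣ V₁ f ∣ * w (suc zero) + ∣ V₂ f ∣ * w (suc (suc zero))
sum-by-value {zero}  w w₀ f = refl
sum-by-value {suc m} w w₀ f with f zero | sum-by-value w w₀ (f ⊙ suc)
... | zero           | ih rewrite w₀ = ih
... | suc zero       | ih =
  trans (cong (λ s → w (suc zero) + s) ih) (sym (ℕ.+-assoc (w (suc zero)) _ _))
... | suc (suc zero) | ih = trans (cong (λ s → w₂ + s) ih)
  (solve 3 (λ a b c → a :+ (b :+ c) := b :+ (a :+ c)) refl w₂ (∣ V₁ (f ⊙ suc) ∣ * w (suc zero)) _)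
  where w₂ = w (suc (suc zero))

weight≡∣V₁∣+2*∣V₂∣ : (f : Fin m → Fin 3) → weight f ≡ ∣ V₁ f ∣ + 2 * ∣ V₂ f ∣
weight≡∣V₁∣+2*∣V₂∣ f = trans (sum-by-value toℕ refl f)
  (cong₂ _+_ (ℕ.*-identityʳ ∣ V₁ f ∣) (ℕ.*-comm ∣ V₂ f ∣ 2))

∑-+ : ∀ m {n} (g : Fin (m + n) → ℕ) →
  ∑[ i < m + n ] g i ≡ ∑[ i < m ] g (i ↑ˡ n) + ∑[ j < n ] g (m ↑ʳ j)
∑-+ zero    g = refl
∑-+ (suc m) g = trans (cong (λ s → g zero + s) (∑-+ m (g ⊙ suc))) (sym (ℕ.+-assoc (g zero) _ _))

∑-* : ∀ m {n} (g : Fin (m * n) → ℕ) →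
  ∑[ p < m * n ] g p ≡ ∑[ i < m ] ∑[ j < n ] g (combine i j)
∑-* zero        g = refl
∑-* (suc m) {n} g = trans (∑-+ n g) (cong (λ s → ∑[ j < n ] g (j ↑ˡ (m * n)) + s) (∑-* m (g ⊙ (n ↑ʳ_))))

-- Lifting a function on G to the product.

fibre : Fin 3 → Fin (suc k) → Fin 3
fibre zero           _       = zero
fibre (suc zero)     _       = suc zero
fibre (suc (suc _))  zero    = suc (suc zero)
fibre (suc (suc _))  (suc _) = suc zero

fibre≡0 : ∀ i (w : Fin (suc k)) → fibre i w ≡ zero → i ≡ zero
fibre≡0 zero           _       _ = refl
fibre≡0 (suc (suc _))  (suc _) ()

-- Only the vertex `zero` of a copy is ever raised to 2, so a vertex of value 2 in the product is
-- determined by its first coordinate.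
fibre≡2 : ∀ i (w : Fin (suc k)) → fibre i w ≡ suc (suc zero) → i ≡ suc (suc zero) × w ≡ zero
fibre≡2 (suc (suc zero)) zero _ = refl , refl

lift : (Fin m → Fin 3) → Fin (m * suc k) → Fin 3
lift {k = k} f p = uncurry (fibre ⊙ f) (remQuot (suc k) p)

∑1 : ∀ n → ∑[ _ < n ] 1 ≡ n
∑1 zero    = refl
∑1 (suc n) = cong suc (∑1 n)

weight-lift : (f : Fin m → Fin 3) →
  weight (lift {k = k} f) ≡ weight f + (∣ V₁ f ∣ + ∣ V₂ f ∣) * k
weight-lift {m} {k} f = begin
  weight (lift {k = k} f)
    ≡⟨ ∑-* m _ ⟩
  ∑[ u < m ] ∑[ v < suc k ] toℕ (lift f (combine u v))
    ≡⟨ sum-cong-≗ (λ u → sum-cong-≗ λ v →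
         cong (toℕ ⊙ uncurry (fibre ⊙ f)) (remQuot-combine u v)) ⟩
  ∑[ u < m ] weight (fibre (f u))
    -- The zero vertex of a copy is split off the sum: it gives 1 over V₁ and 2 over V₂, and the
    -- other `k` vertices give 1 each.
    ≡⟨ sum-by-value (λ i → weight (fibre {k} i)) (sum-replicate-zero (suc k)) f ⟩
  ∣ V₁ f ∣ * suc (∑[ _ < k ] 1) + ∣ V₂ f ∣ * suc (suc (∑[ _ < k ] 1))
    ≡⟨ cong (λ j → ∣ V₁ f ∣ * suc j + ∣ V₂ f ∣ * suc (suc j)) (∑1 k) ⟩
  ∣ V₁ f ∣ * suc k + ∣ V₂ f ∣ * suc (suc k)
    ≡⟨ solve 3 (λ a b k → a :* (con 1 :+ k) :+ b :* (con 2 :+ k)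
                       := a :+ con 2 :* b :+ (a :+ b) :* k) refl ∣ V₁ f ∣ ∣ V₂ f ∣ k ⟩
  ∣ V₁ f ∣ + 2 * ∣ V₂ f ∣ + (∣ V₁ f ∣ + ∣ V₂ f ∣) * k
    ≡⟨ cong (λ s → s + (∣ V₁ f ∣ + ∣ V₂ f ∣) * k) (weight≡∣V₁∣+2*∣V₂∣ f) ⟨
  weight f + (∣ V₁ f ∣ + ∣ V₂ f ∣) * k ∎
  where open ≡-Reasoning

module _ (G : Graph m) where
  open Graph G

  ∈-N∩⁺ : ∀ {u v S} → u ~ v → v ∈ S → v ∈ N u ∩ S
  ∈-N∩⁺ {u} u~v v∈S = x∈p∩q⁺ (∈-comprehension⁺ (u ~?_) u~v , v∈S)

  ∈-N∩⁻ : ∀ {u v S} → v ∈ N u ∩ S → u ~ v × v ∈ S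
  ∈-N∩⁻ {u} {S = S} v∈ with v∈N , v∈S ← x∈p∩q⁻ (N u) S v∈ =
    ∈-comprehension⁻ (u ~?_) v∈N , v∈S

V₂⁺ : (f : Fin m → Fin 3) → ∀ {v} → f v ≡ suc (suc zero) → v ∈ V₂ f
V₂⁺ f = ∈-comprehension⁺ (λ v → f v ≟ suc (suc zero))

V₂⁻ : (f : Fin m → Fin 3) → ∀ {v} → v ∈ V₂ f → f v ≡ suc (suc zero)
V₂⁻ f = ∈-comprehension⁻ (λ v → f v ≟ suc (suc zero))

lift-isPRDF : (G : Graph m) (H : Graph (suc k)) (f : Fin m → Fin 3) →
  IsPRDF G f → IsPRDF (G ∘ H) (lift f)
lift-isPRDF {m} {k} G H f prdf p fp≡0 = unique⇒∣p∣≡1 x₀∈ unique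
  where
  open Graph G using (_~_; N)

  rq : Fin (m * suc k) → Fin m × Fin (suc k)
  rq = remQuot (suc k)

  u : Fin m
  u = proj₁ (rq p)

  fu≡0 : f u ≡ zero
  fu≡0 = fibre≡0 (f u) (proj₂ (rq p)) fp≡0

  singleton : ∃ λ x → N u ∩ V₂ f ≡ ⁅ x ⁆
  singleton = ∣p∣≡1⇒p≡⁅x⁆ _ (prdf u fu≡0)

  x : Fin m
  x = proj₁ singleton

  x∈ : u ~ x × x ∈ V₂ f
  x∈ = ∈-N∩⁻ G (subst (x ∈_) (sym (proj₂ singleton)) (x∈⁅x⁆ x))

  x₀ : Fin (m * suc k)
  x₀ = combine x zero

  x₀∈ : x₀ ∈ Graph.N (G ∘ H) p ∩ V₂ (lift f)
  x₀∈ = ∈-N∩⁺ (G ∘ H)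
    -- An edge of G joins all vertices of the two copies, whatever the second coordinates are.
    (inj₁ (subst (u ~_) (sym (cong proj₁ (remQuot-combine x (zero {k})))) (proj₁ x∈)))
    (V₂⁺ (lift f) (trans (cong (uncurry (fibre ⊙ f)) (remQuot-combine x zero))
                         (cong (λ i → fibre i zero) (V₂⁻ f (proj₂ x∈)))))

  unique : ∀ {q} → q ∈ Graph.N (G ∘ H) p ∩ V₂ (lift f) → q ≡ x₀
  unique {q} q∈ with adj , q∈V₂ ← ∈-N∩⁻ (G ∘ H) q∈
    with fy≡2 , w≡0 ← fibre≡2 (f (proj₁ (rq q))) _ (V₂⁻ (lift f) q∈V₂) | adj
  -- A neighbour of value 2 in the same copy would give `f u` both values 0 and 2.
  ... | inj₂ (u≡y , _) = case trans (sym fu≡0) (trans (cong f u≡y) fy≡2) of λ ()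
  ... | inj₁ u~y = trans (sym (combine-remQuot {m} (suc k) q)) (cong₂ combine y≡x w≡0)
    where
    y≡x : proj₁ (rq q) ≡ x
    y≡x = x∈⁅y⁆⇒x≡y x (subst (_ ∈_) (proj₂ singleton) (∈-N∩⁺ G u~y (V₂⁺ f fy≡2)))

-- Stated for every PRDF, not only those of minimum weight, because the function built for (iii)
-- need not be minimum.
γᵖᴿ-∘-≤ : (G : Graph m) (H : Graph n) (f : Fin m → Fin 3) → IsPRDF G f →
  γᵖᴿ (G ∘ H) ≤ weight f + (∣ V₁ f ∣ + ∣ V₂ f ∣) * (n ∸ 1)
γᵖᴿ-∘-≤ {n = zero}  G H f prdf = ⊥-elim (≢-nonZero⁻¹ 0 {{Graph.nonEmpty H}} refl)
γᵖᴿ-∘-≤ {n = suc k} G H f prdf =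
  proj₂ (proj₂ (γᵖᴿ-least (G ∘ H))) (lift f , lift-isPRDF G H f prdf , weight-lift f)

-- The function attached to a perfect dominating set.

label : Bool → Bool → Fin 3
label true  _     = suc zero
label false true  = suc (suc zero)
label false false = zero

-- The function with V₁ = p and V₂ = q ─ p.
labelling : (p q : Subset n) → Fin n → Fin 3
labelling p q v = label (lookup p v) (lookup q v)

V₁-labelling : (p q : Subset n) → V₁ (labelling p q) ≡ p
V₁-labelling []          []          = refl
V₁-labelling (true  ∷ p) (_     ∷ q) = cong (true  ∷_) (V₁-labelling p q)
V₁-labelling (false ∷ p) (true  ∷ q) = cong (false ∷_) (V₁-labelling p q)
V₁-labelling (false ∷ p) (false ∷ q) = cong (false ∷_) (V₁-labelling p q)

V₂-labelling : (p q : Subset n) → V₂ (labelling p q) ≡ q ─ p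
V₂-labelling []          []          = refl
V₂-labelling (true  ∷ p) (_     ∷ q) = cong (false ∷_) (V₂-labelling p q)
V₂-labelling (false ∷ p) (true  ∷ q) = cong (true  ∷_) (V₂-labelling p q)
V₂-labelling (false ∷ p) (false ∷ q) = cong (false ∷_) (V₂-labelling p q)

labelling≡0⇒∉ : ∀ (p q : Subset n) {v} → labelling p q v ≡ zero → v ∉ q
labelling≡0⇒∉ p q {v} eq v∈q with lookup p v | lookup q v | []=⇒lookup v∈q
labelling≡0⇒∉ p q {v} () v∈q | true  | _    | _
labelling≡0⇒∉ p q {v} () v∈q | false | true | _

module _ (G : Graph m) (S : Subset m) where
  open Graph G

  ∈-epn⁺ : ∀ {u v} → u ∉ S → N u ∩ S ≡ ⁅ v ⁆ → u ∈ epn G v S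
  ∈-epn⁺ {v = v} u∉S eq = ∈-comprehension⁺
    (λ u → ¬? (u ∈? S) ×-dec ≡-dec _≟ᵇ_ (N u ∩ S) ⁅ v ⁆) (u∉S , eq)

  ∈-withoutEpn⁻ : ∀ {x} → x ∈ withoutEpn G S → x ∈ S × ¬ Nonempty (epn G x S)
  ∈-withoutEpn⁻ = ∈-comprehension⁻ (λ x → (x ∈? S) ×-dec ¬? (nonempty? (epn G x S)))

labelling-isPRDF : (G : Graph m) (S : Subset m) → PerfectDominating G S →
  IsPRDF G (labelling (withoutEpn G S) S)
labelling-isPRDF G S pd u fu≡0 rewrite V₂-labelling (withoutEpn G S) S
  -- A vertex of value 0 lies outside S, so perfect domination supplies its only neighbour `x` in S.
  with u∉S ← labelling≡0⇒∉ (withoutEpn G S) S fu≡0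
  with x , N∩S≡⁅x⁆ ← ∣p∣≡1⇒p≡⁅x⁆ _ (pd u u∉S)
  with u~x , x∈S ← ∈-N∩⁻ G {S = S} (subst (x ∈_) (sym N∩S≡⁅x⁆) (x∈⁅x⁆ x)) =
  unique⇒∣p∣≡1
    (∈-N∩⁺ G u~x (x∈p∧x∉q⇒x∈p─q x∈S λ x∈ →
      -- The vertex `u` itself is an external private neighbour of `x`, so `x` is not in S′.
      proj₂ (∈-withoutEpn⁻ G S x∈) (u , ∈-epn⁺ G S u∉S N∩S≡⁅x⁆)))
    -- Uniqueness passes from S to its subset S″.
    (λ y∈ → let u~y , y∈S″ = ∈-N∩⁻ G {S = S ─ withoutEpn G S} y∈ in
      x∈⁅y⁆⇒x≡y x (subst (_ ∈_) N∩S≡⁅x⁆ (∈-N∩⁺ G u~y (p─q⊆p S (withoutEpn G S) y∈S″))))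

-- Reduces the integer difference in (ii) to an identity between natural numbers without subtraction
-- of `b`.
c≤a∧a+b≡d⇒c≤d-b : ∀ {a b c d} → c ≤ a → a + b ≡ d → + c ≤ᶻ + d -ᶻ + b
c≤a∧a+b≡d⇒c≤d-b {a} {b} c≤a refl = subst (_ ≤ᶻ_) (sym a+b-b≡a) (+≤+ c≤a)
  where
  open ≡-Reasoning
  a+b-b≡a : + (a + b) -ᶻ + b ≡ + a
  a+b-b≡a = begin
    + (a + b) -ᶻ + b   ≡⟨ ℤ.m-n≡m⊖n (a + b) b ⟩
    (a + b) ⊖ b        ≡⟨ ℤ.⊖-≥ (ℕ.m≤n+m b a) ⟩
    + (a + b ∸ b)      ≡⟨ cong (λ i → + i) (ℕ.m+n∸n≡m a b) ⟩
    + a                ∎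

theorem4p2 : ∀ {m n : ℕ} (G : Graph m) (H : Graph n) → NoIsolatedVertices G →
    (∀ (f : Fin m → Fin 3) → IsγᵖᴿFunction G f →
    γᵖᴿ (G ∘ H) ≤ γᵖᴿ G + (∣ V₁ f ∣ + ∣ V₂ f ∣) * (n ∸ 1))
    × ((∃ λ (f : Fin m → Fin 3) → IsγᵖᴿFunction G f × IsγSet G (V₂ f)) →
    + γᵖᴿ (G ∘ H) ≤ᶻ + (γᵖᴿ G * n) -ᶻ + (γ G * (n ∸ 1)))
    × (∀ (S : Subset m) → IsγᵖSet G S →
    γᵖᴿ (G ∘ H) ≤ ∣ withoutEpn G S ∣ + 2 * ∣ S ─ withoutEpn G S ∣ + γᵖ G * (n ∸ 1))
    × ((∃ λ (f : Fin m → Fin 3) → IsγᵖᴿFunction G f × IsγᵖSet G (V₁ f ∪ V₂ f)) →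
    γᵖᴿ (G ∘ H) ≤ γᵖᴿ G + γᵖ G * (n ∸ 1))
theorem4p2 {m} {n} G H _ = part-i , part-ii , part-iii , part-iv
  where
  part-i : ∀ f → IsγᵖᴿFunction G f →
    γᵖᴿ (G ∘ H) ≤ γᵖᴿ G + (∣ V₁ f ∣ + ∣ V₂ f ∣) * (n ∸ 1)
  part-i f (prdf , w≡γ) =
    subst (λ w → γᵖᴿ (G ∘ H) ≤ w + (∣ V₁ f ∣ + ∣ V₂ f ∣) * (n ∸ 1)) w≡γ (γᵖᴿ-∘-≤ G H f prdf)

  n≡1+[n∸1] : n ≡ suc (n ∸ 1)
  n≡1+[n∸1] = sym (ℕ.suc-pred n {{Graph.nonEmpty H}})

  part-ii : (∃ λ f → IsγᵖᴿFunction G f × IsγSet G (V₂ f)) →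
    + γᵖᴿ (G ∘ H) ≤ᶻ + (γᵖᴿ G * n) -ᶻ + (γ G * (n ∸ 1))
  -- With `b = γ G`, adding `γ G * l` to the bound of (i) turns `(a + b) * l` into
  -- `(a + 2 * b) * l`, which is `γᵖᴿ G * l`.
  part-ii (f , fγ@(_ , w≡γ) , (_ , ∣V₂∣≡γ)) = c≤a∧a+b≡d⇒c≤d-b (part-i f fγ) (begin
    γᵖᴿ G + (a + b) * l + γ G * l
      ≡⟨ cong₂ (λ x y → x + (a + b) * l + y * l) γᵖᴿ≡ (sym ∣V₂∣≡γ) ⟩
    a + 2 * b + (a + b) * l + b * l
      ≡⟨ solve 3 (λ a b k → a :+ con 2 :* b :+ (a :+ b) :* k :+ b :* k
                         := (a :+ con 2 :* b) :* (con 1 :+ k)) refl a b l ⟩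
    (a + 2 * b) * suc l
      ≡⟨ cong₂ _*_ γᵖᴿ≡ n≡1+[n∸1] ⟨
    γᵖᴿ G * n ∎)
    where
    open ≡-Reasoning
    a = ∣ V₁ f ∣
    b = ∣ V₂ f ∣
    l = n ∸ 1
    γᵖᴿ≡ : γᵖᴿ G ≡ a + 2 * b
    γᵖᴿ≡ = trans (sym w≡γ) (weight≡∣V₁∣+2*∣V₂∣ f)

  part-iii : ∀ S → IsγᵖSet G S →
    γᵖᴿ (G ∘ H) ≤ ∣ withoutEpn G S ∣ + 2 * ∣ S ─ withoutEpn G S ∣ + γᵖ G * (n ∸ 1)
  part-iii S (pd , ∣S∣≡γᵖ) = subst (γᵖᴿ (G ∘ H) ≤_)
    (cong₂ (λ x y → x + y * (n ∸ 1)) weight≡ size≡)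
    (γᵖᴿ-∘-≤ G H f (labelling-isPRDF G S pd))
    where
    S′ = withoutEpn G S
    f  = labelling S′ S
    ∣V₁∣≡ : ∣ V₁ f ∣ ≡ ∣ S′ ∣
    ∣V₁∣≡ = cong ∣_∣ (V₁-labelling S′ S)
    ∣V₂∣≡ : ∣ V₂ f ∣ ≡ ∣ S ─ S′ ∣
    ∣V₂∣≡ = cong ∣_∣ (V₂-labelling S′ S)
    weight≡ : weight f ≡ ∣ S′ ∣ + 2 * ∣ S ─ S′ ∣
    weight≡ = trans (weight≡∣V₁∣+2*∣V₂∣ f) (cong₂ (λ x y → x + 2 * y) ∣V₁∣≡ ∣V₂∣≡)
    size≡ : ∣ V₁ f ∣ + ∣ V₂ f ∣ ≡ γᵖ G
    size≡ = begin
      ∣ V₁ f ∣ + ∣ V₂ f ∣   ≡⟨ cong₂ _+_ ∣V₁∣≡ ∣V₂∣≡ ⟩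
      ∣ S′ ∣ + ∣ S ─ S′ ∣   ≡⟨ ∣p∪q∣≡∣p∣+∣q─p∣ S′ S ⟨
      -- S′ is contained in S, so the union collapses to S.
      ∣ S′ ∪ S ∣            ≡⟨ cong ∣_∣ (p⊆q⇒p∪q≡q (proj₁ ⊙ ∈-withoutEpn⁻ G S)) ⟩
      ∣ S ∣                 ≡⟨ ∣S∣≡γᵖ ⟩
      γᵖ G                  ∎
      where open ≡-Reasoning

  part-iv : (∃ λ f → IsγᵖᴿFunction G f × IsγᵖSet G (V₁ f ∪ V₂ f)) →
    γᵖᴿ (G ∘ H) ≤ γᵖᴿ G + γᵖ G * (n ∸ 1)
  part-iv (f , fγ , (_ , ∣V₁∪V₂∣≡γᵖ)) =
    subst (λ s → γᵖᴿ (G ∘ H) ≤ γᵖᴿ G + s * (n ∸ 1))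
          (trans (sym (∣V₁∪V₂∣≡∣V₁∣+∣V₂∣ f)) ∣V₁∪V₂∣≡γᵖ) (part-i f fγ)
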